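{- Let $\mathbf{P}\subseteq\mathbb{N}$ and suppose that for every MLO formula $\psi(X,Y,P)$, either there is a recursive C-operator $F$ with $\langle\mathbb{N},<\rangle\models\forall X\,\psi(X,F(X),\mathbf{P})$ or there is a recursive SC-operator $G$ with $\langle\mathbb{N},<\rangle\models\forall Y\,\neg\psi(G(Y),Y,\mathbf{P})$, and moreover it is decidable which case holds and the corresponding operator is computable from $\psi$. Then Problems 1, 2 and 3 for $\mathbf{P}$ are computable.
   Context: MLO is monadic second-order logic over $<$ and unary predicate symbols, with set variables ranging over subsets of $\mathbb{N}$ (identified with $\omega$-strings over $\{0,1\}$). An operator (of one argument, or of two arguments $F(X,P)$ viewed as an operator on $\omega$-strings over $\{0,1\}^2$) is causal (C-operator) if whenever inputs coincide on $[0,t]$ the outputs coincide on $[0,t]$; strongly causal (SC-operator) if whenever inputs coincide on $[0,t)$ the outputs coincide on $[0,t]$; recursive if the map from a finite input prefix $a_0\dots a_n$ to the $n$-th output letter is computable. Problems (input an MLO formula $\psi(X,Y,P)$; computable means some algorithm solves it on all inputs): Problem 1: decide whether there is a C-operator $F(X,P)$ with $\langle\mathbb{N},<\rangle\models\forall X\,\psi(X,F(X,\mathbf{P}),\mathbf{P})$, and if there is such a recursive one, construct it. Problem 2: decide whether there is a recursive C-operator $F(X,P)$ with that property, and if so construct it. Problem 3: decide whether there is a recursive C-operator $F(X)$ with $\langle\mathbb{N},<\rangle\models\forall X\,\psi(X,F(X),\mathbf{P})$, and if so construct it. -}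

module Defs where

open import Data.Nat using (ℕ; zero; suc; _+_; _*_; _<_; _≤_)
open import Data.Bool using (Bool; true; false)
open import Data.Fin using (Fin)
open import Data.Vec using (Vec; []; _∷_; lookup)
open import Data.Product using (Σ; _×_)
open import Data.Sum using (_⊎_)
open import Data.Maybe using (Maybe; just)
open import Data.Empty using (⊥)
open import Relation.Nullary using (¬_; Dec)
open import Relation.Binary.PropositionalEquality using (_≡_)

-- ω-strings over {0,1} = subsets of ℕ

Str : Set
Str = ℕ → Bool

-- MLO: monadic second-order logic over ⟨ℕ,<⟩.
-- Form m n : formulas with first-order variables among Fin m and
-- set (monadic second-order) variables among Fin n.

data Form (m n : ℕ) : Set where
  _<′_  : Fin m → Fin m → Form m n
  _≐_   : Fin m → Fin m → Form m n
  _∈′_  : Fin m → Fin n → Form m n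
  ¬′_   : Form m n → Form m n
  _∧′_  : Form m n → Form m n → Form m n
  ∃₁    : Form (suc m) n → Form m n
  ∃₂    : Form m (suc n) → Form m n

Sat : ∀ {m n} → Form m n → Vec ℕ m → Vec Str n → Set
Sat (x <′ y) ρ σ = lookup ρ x < lookup ρ y
Sat (x ≐ y)  ρ σ = lookup ρ x ≡ lookup ρ y
Sat (x ∈′ X) ρ σ = lookup σ X (lookup ρ x) ≡ true
Sat (¬′ φ)   ρ σ = ¬ Sat φ ρ σ
Sat (φ ∧′ χ) ρ σ = Sat φ ρ σ × Sat χ ρ σ
Sat (∃₁ φ)   ρ σ = Σ ℕ (λ k → Sat φ (k ∷ ρ) σ)
Sat (∃₂ φ)   ρ σ = Σ Str (λ S → Sat φ ρ (S ∷ σ))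

-- A formula ψ(X,Y,P): no free first-order variables, set variables
-- 0 = X, 1 = Y, 2 = P.
Formula : Set
Formula = Form 0 3

Holds : Formula → Str → Str → Str → Set
Holds ψ A B C = Sat ψ [] (A ∷ B ∷ C ∷ [])

Op1 : Set
Op1 = Str → Str

Op2 : Set
Op2 = Str → Str → Str

AgreeUpTo : Str → Str → ℕ → Set
AgreeUpTo A B t = ∀ i → i ≤ t → A i ≡ B i

AgreeBelow : Str → Str → ℕ → Set
AgreeBelow A B t = ∀ i → i < t → A i ≡ B i

IsC1 : Op1 → Set
IsC1 F = ∀ X X′ t → AgreeUpTo X X′ t → AgreeUpTo (F X) (F X′) t

IsSC1 : Op1 → Set
IsSC1 F = ∀ X X′ t → AgreeBelow X X′ t → AgreeUpTo (F X) (F X′) t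

-- two-argument operator = operator on ω-strings over {0,1}²
IsC2 : Op2 → Set
IsC2 F = ∀ X X′ P P′ t → AgreeUpTo X X′ t → AgreeUpTo P P′ t →
         AgreeUpTo (F X P) (F X′ P′) t

-- Computability: partial recursive functions (Kleene), as codes with a
-- big-step evaluation relation.

data PR : ℕ → Set where
  Zr : ∀ {k} → PR k
  Sc : PR 1
  Pj : ∀ {k} → Fin k → PR k
  Cm : ∀ {j k} → PR j → Vec (PR k) j → PR k
  Rc : ∀ {k} → PR k → PR (suc (suc k)) → PR (suc k)
  Mn : ∀ {k} → PR (suc k) → PR k

mutual
  data _[_]⇓_ : ∀ {k} → PR k → Vec ℕ k → ℕ → Set where
    zr   : ∀ {k} {xs : Vec ℕ k} → Zr [ xs ]⇓ 0
    sc   : ∀ {x} → Sc [ x ∷ [] ]⇓ suc x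
    pj   : ∀ {k} {xs : Vec ℕ k} (i : Fin k) → Pj i [ xs ]⇓ lookup xs i
    cm   : ∀ {j k} {f : PR j} {gs : Vec (PR k) j} {xs ys z} →
           gs [ xs ]⇓* ys → f [ ys ]⇓ z → Cm f gs [ xs ]⇓ z
    rc0  : ∀ {k} {f : PR k} {g xs z} → f [ xs ]⇓ z → Rc f g [ 0 ∷ xs ]⇓ z
    rcS  : ∀ {k} {f : PR k} {g xs n r z} →
           Rc f g [ n ∷ xs ]⇓ r → g [ n ∷ r ∷ xs ]⇓ z →
           Rc f g [ suc n ∷ xs ]⇓ z
    mn   : ∀ {k} {f : PR (suc k)} {xs z} →
           f [ z ∷ xs ]⇓ 0 →
           (∀ y → y < z → Σ ℕ (λ v → f [ y ∷ xs ]⇓ suc v)) →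
           Mn f [ xs ]⇓ z

  data _[_]⇓*_ : ∀ {j k} → Vec (PR k) j → Vec ℕ k → Vec ℕ j → Set where
    []  : ∀ {k} {xs : Vec ℕ k} → [] [ xs ]⇓* []
    _∷_ : ∀ {j k} {g : PR k} {gs : Vec (PR k) j} {xs y ys} →
          g [ xs ]⇓ y → gs [ xs ]⇓* ys → (g ∷ gs) [ xs ]⇓* (y ∷ ys)

bit : Bool → ℕ
bit false = 0
bit true  = 1

-- code of the finite prefix A(0)…A(n-1): binary numeral 1 A(0) … A(n-1)
pre : Str → ℕ → ℕ
pre A zero    = 1
pre A (suc n) = 2 * pre A n + bit (A n)

-- e computes the prefix map a₀…aₙ ↦ n-th output letter of F
Computes1 : PR 1 → Op1 → Set
Computes1 e F = ∀ X n → e [ pre X (suc n) ∷ [] ]⇓ bit (F X n)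

-- for an operator on {0,1}²-strings the prefix (a₀,p₀)…(aₙ,pₙ) is
-- given as the pair of codes of its two components
Computes2 : PR 2 → Op2 → Set
Computes2 e F = ∀ X P n →
  e [ pre X (suc n) ∷ pre P (suc n) ∷ [] ]⇓ bit (F X P n)

COp2Sol : Formula → Str → Set
COp2Sol ψ P = Σ Op2 (λ F → IsC2 F × (∀ X → Holds ψ X (F X P) P))

RecCOp2Sol : Formula → Str → PR 2 → Set
RecCOp2Sol ψ P e = Σ Op2 (λ F → IsC2 F × Computes2 e F ×
                                  (∀ X → Holds ψ X (F X P) P))

RecCOp1Sol : Formula → Str → PR 1 → Set
RecCOp1Sol ψ P e = Σ Op1 (λ F → IsC1 F × Computes1 e F ×
                                  (∀ X → Holds ψ X (F X) P))

RecSCOp1Counter : Formula → Str → PR 1 → Set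
RecSCOp1Counter ψ P e = Σ Op1 (λ G → IsSC1 G × Computes1 e G ×
                                       (∀ Y → Holds (¬′ ψ) (G Y) Y P))

Constructs : ∀ {k} → (PR k → Set) → Maybe (PR k) → Set
Constructs {k} Sol m =
  (∀ (e : PR k) → m ≡ just e → Sol e) ×
  (Σ (PR k) Sol → Σ (PR k) (λ e → m ≡ just e))

Hyp : Str → Set
Hyp P = (ψ : Formula) →
  Σ (PR 1) (RecCOp1Sol ψ P) ⊎ Σ (PR 1) (RecSCOp1Counter ψ P)

Problem1 : Str → Set
Problem1 P = (ψ : Formula) →
  Dec (COp2Sol ψ P) × Σ (Maybe (PR 2)) (Constructs (RecCOp2Sol ψ P))

Problem2 : Str → Set
Problem2 P = (ψ : Formula) → Σ (Maybe (PR 2)) (Constructs (RecCOp2Sol ψ P))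

Problem3 : Str → Set
Problem3 P = (ψ : Formula) → Σ (Maybe (PR 1)) (Constructs (RecCOp1Sol ψ P))

module Submission where

-- Iterating a strongly causal operator from any string fixes one more letter at
-- each step, so every SC-operator has a fixed point.  If F is a C-operator
-- solving ψ and G an SC-operator refuting it, F ∘ G is strongly causal; at its
-- fixed point Y we get ψ(G Y, F (G Y), P) = ψ(G Y, Y, P) and ¬ψ(G Y, Y, P).
-- Hence the two alternatives of the hypothesis exclude each other, and the
-- one that holds answers all three problems.

open import Defs
open import Function using (_∘_)
open import Data.Product using (Σ; _×_; _,_)
open import Data.Nat using (ℕ; zero; suc; s≤s; _≤′_; ≤′-refl; ≤′-step)
open import Data.Nat.Properties using (≤-refl; ≤-trans; ≤⇒≤′; ≤′⇒≤)
open import Data.Bool using (false)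
open import Data.Fin using (zero; suc)
open import Data.Vec using (Vec; []; _∷_; lookup)
open import Data.Sum using (inj₁; inj₂)
open import Data.Maybe using (just; nothing)
open import Data.Empty using (⊥; ⊥-elim)
open import Relation.Nullary using (¬_; yes; no)
open import Relation.Binary.PropositionalEquality
  using (_≡_; _≗_; refl; sym; trans)

_≋_ : ∀ {n} → Vec Str n → Vec Str n → Set
σ ≋ σ′ = ∀ i → lookup σ i ≗ lookup σ′ i

≋-sym : ∀ {n} {σ σ′ : Vec Str n} → σ ≋ σ′ → σ′ ≋ σ
≋-sym σ≋σ′ i k = sym (σ≋σ′ i k)

∷-cong : ∀ {n} {σ σ′ : Vec Str n} (S : Str) → σ ≋ σ′ → (S ∷ σ) ≋ (S ∷ σ′)
∷-cong S σ≋σ′ zero    k = refl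
∷-cong S σ≋σ′ (suc i) k = σ≋σ′ i k

Sat-resp-≋ : ∀ {m n} (φ : Form m n) (ρ : Vec ℕ m) {σ σ′ : Vec Str n} →
             σ ≋ σ′ → Sat φ ρ σ → Sat φ ρ σ′
Sat-resp-≋ (x <′ y) ρ σ≋σ′ s        = s
Sat-resp-≋ (x ≐ y)  ρ σ≋σ′ s        = s
Sat-resp-≋ (x ∈′ X) ρ σ≋σ′ s        = trans (sym (σ≋σ′ X (lookup ρ x))) s
Sat-resp-≋ (¬′ φ)   ρ {σ} {σ′} σ≋σ′ ¬s s′ =
  ¬s (Sat-resp-≋ φ ρ (≋-sym {σ = σ} {σ′} σ≋σ′) s′)
Sat-resp-≋ (φ ∧′ χ) ρ σ≋σ′ (s , t)  = Sat-resp-≋ φ ρ σ≋σ′ s , Sat-resp-≋ χ ρ σ≋σ′ t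
Sat-resp-≋ (∃₁ φ)   ρ σ≋σ′ (k , s)  = k , Sat-resp-≋ φ (k ∷ ρ) σ≋σ′ s
Sat-resp-≋ (∃₂ φ)   ρ σ≋σ′ (S , s)  = S , Sat-resp-≋ φ ρ (∷-cong S σ≋σ′) s

Holds-respʸ : ∀ ψ {X Y Y′ P} → Y ≗ Y′ → Holds ψ X Y P → Holds ψ X Y′ P
Holds-respʸ ψ Y≗Y′ = Sat-resp-≋ ψ [] λ where
  zero             k → refl
  (suc zero)       k → Y≗Y′ k
  (suc (suc zero)) k → refl

∘-isSC1 : ∀ {F G} → IsC1 F → IsSC1 G → IsSC1 (F ∘ G)
∘-isSC1 {G = G} F-c G-sc Z Z′ t Z≈Z′ = F-c (G Z) (G Z′) t (G-sc Z Z′ t Z≈Z′)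

SC-fixedPoint : ∀ H → IsSC1 H → Σ Str λ Y → H Y ≗ Y
SC-fixedPoint H H-sc = Y , H-Y≗Y
  where
  iterate : ℕ → Str
  iterate zero    = λ _ → false
  iterate (suc k) = H (iterate k)

  iterate-step : ∀ k → AgreeBelow (iterate k) (iterate (suc k)) k
  iterate-step (suc k) i (s≤s i≤k) =
    H-sc (iterate k) (iterate (suc k)) k (iterate-step k) i i≤k

  iterate-settled : ∀ {k j} → k ≤′ j → AgreeBelow (iterate k) (iterate j) k
  iterate-settled ≤′-refl          i i<k = refl
  iterate-settled (≤′-step {j} k≤j) i i<k =
    trans (iterate-settled k≤j i i<k) (iterate-step j i (≤-trans i<k (≤′⇒≤ k≤j)))

  -- the t-th letter is read off once it has settled, after t + 1 steps
  Y : Str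
  Y t = iterate (suc t) t

  H-Y≗Y : H Y ≗ Y
  H-Y≗Y t = H-sc Y (iterate t) t
    (λ i i<t → iterate-settled (≤⇒≤′ i<t) i ≤-refl) t ≤-refl

C-solution-excludes-SC-counter :
  ∀ ψ P {F G} → IsC1 F → (∀ X → Holds ψ X (F X) P) →
  IsSC1 G → (∀ Y → Holds (¬′ ψ) (G Y) Y P) → ⊥
C-solution-excludes-SC-counter ψ P {F} {G} F-c F-sol G-sc G-counter
  with SC-fixedPoint (F ∘ G) (∘-isSC1 F-c G-sc)
... | Y , FGY≗Y = G-counter Y (Holds-respʸ ψ FGY≗Y (F-sol (G Y)))

COp2Sol⇒¬counter : ∀ ψ P → COp2Sol ψ P → ¬ Σ (PR 1) (RecSCOp1Counter ψ P)
COp2Sol⇒¬counter ψ P (F , F-c , F-sol) (_ , G , G-sc , _ , G-counter) =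
  C-solution-excludes-SC-counter ψ P
    (λ X X′ t X≈X′ → F-c X X′ P P t X≈X′ λ _ _ → refl) F-sol G-sc G-counter

RecCOp2Sol⇒COp2Sol : ∀ {ψ P e} → RecCOp2Sol ψ P e → COp2Sol ψ P
RecCOp2Sol⇒COp2Sol (F , F-c , _ , F-sol) = F , F-c , F-sol

ignoreSecond : PR 1 → PR 2
ignoreSecond e = Cm e (Pj zero ∷ [])

RecCOp1Sol⇒RecCOp2Sol : ∀ {ψ P e} → RecCOp1Sol ψ P e →
                        RecCOp2Sol ψ P (ignoreSecond e)
RecCOp1Sol⇒RecCOp2Sol (F , F-c , F-comp , F-sol) =
  (λ X _ → F X) ,
  (λ X X′ _ _ t X≈X′ _ → F-c X X′ t X≈X′) ,
  (λ X _ n → cm (pj zero ∷ []) (F-comp X n)) ,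
  F-sol

constructs-just : ∀ {k} {Sol : PR k → Set} {e} → Sol e → Constructs Sol (just e)
constructs-just sol = (λ { _ refl → sol }) , λ _ → _ , refl

constructs-nothing : ∀ {k} {Sol : PR k → Set} → ¬ Σ (PR k) Sol → Constructs Sol nothing
constructs-nothing ¬sol = (λ _ ()) , λ sol → ⊥-elim (¬sol sol)

lemma3p4 : (P : Str) → Hyp P → Problem1 P × Problem2 P × Problem3 P
lemma3p4 P hyp = problem1 , problem2 , problem3
  where
  problem2 : Problem2 P
  problem2 ψ with hyp ψ
  ... | inj₁ (_ , sol) = _ , constructs-just (RecCOp1Sol⇒RecCOp2Sol sol)
  ... | inj₂ counter   = nothing , constructs-nothing λ (_ , sol) →
          COp2Sol⇒¬counter ψ P (RecCOp2Sol⇒COp2Sol sol) counter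

  problem1 : Problem1 P
  problem1 ψ with hyp ψ
  ... | inj₁ (_ , sol) = yes (RecCOp2Sol⇒COp2Sol (RecCOp1Sol⇒RecCOp2Sol sol)) , problem2 ψ
  ... | inj₂ counter   = no (λ sol → COp2Sol⇒¬counter ψ P sol counter) , problem2 ψ

  problem3 : Problem3 P
  problem3 ψ with hyp ψ
  ... | inj₁ (_ , sol) = _ , constructs-just sol
  ... | inj₂ (_ , G , G-sc , _ , G-counter) = nothing , constructs-nothing
          λ (_ , F , F-c , _ , F-sol) →
            C-solution-excludes-SC-counter ψ P F-c F-sol G-sc G-counter
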